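{- Let $n\ge 3$, $1\le t<n$, and let $c_1,c_2,\ldots,c_t\in[n]$ be distinct integers such that the sequence $(c_1,\ldots,c_t)$ avoids both patterns $132$ and $312$. If $\{c_1,\ldots,c_t\}$ is a set of consecutive integers, then $$|S_{n,(c_1,\ldots,c_t)}(132,312)|=\binom{n-t}{\min\{c_1,\ldots,c_t\}-1};$$ otherwise, $|S_{n,(c_1,\ldots,c_t)}(132,312)|=0$.
   Context: $[n]=\{1,\ldots,n\}$ and $S_n$ is the set of permutations of $[n]$ written as sequences $(\tau(1),\ldots,\tau(n))$. A sequence of distinct integers $\tau=(\tau(1),\ldots,\tau(m))$ contains $\sigma\in S_k$ as a pattern if there are indices $1\le i_1<\cdots<i_k\le m$ such that for all $1\le a<b\le k$, $\tau(i_a)<\tau(i_b)$ if and only if $\sigma(a)<\sigma(b)$; otherwise $\tau$ avoids $\sigma$. $S_{n,(c_1,\ldots,c_t)}(\sigma_1,\ldots,\sigma_m)$ is the set of $\tau\in S_n$ with $(\tau(1),\ldots,\tau(t))=(c_1,\ldots,c_t)$ that avoid all of $\sigma_1,\ldots,\sigma_m$. A set of $t$ integers is a set of consecutive integers if it equals $\{x,x+1,\ldots,x+t-1\}$ for some $x$. -}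

module Defs where

open import Data.Fin.Base as Fin using (Fin; toℕ; inject≤)
open import Data.Fin.Permutation using (Permutation′; _⟨$⟩ʳ_)
open import Data.List.Base using (List; length)
import Data.List.Membership.Propositional as List
import Data.List.Relation.Unary.All as List
import Data.List.Relation.Unary.Unique.Propositional as List
open import Data.Nat.Base using (ℕ; suc; _+_; _≤_; _<_; _⊓_; s≤s)
open import Data.Product.Base using (∃; ∃-syntax; Σ-syntax; _×_; _,_)
open import Data.Vec.Base using (Vec; []; _∷_; lookup; foldr₁)
open import Data.Vec.Membership.Propositional using (_∈_)
open import Function.Bundles using (_⇔_)
open import Level using (Level; _⊔_)
open import Relation.Binary.PropositionalEquality.Core using (_≡_)
open import Relation.Nullary.Negation.Core using (¬_)
open import Relation.Unary using (Pred)

private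
  variable
    a p : Level
    k m n t : ℕ

infix 4 _∈[1⋯_] _Contains_ _Avoids_

_∈[1⋯_] : ℕ → ℕ → Set
x ∈[1⋯ n ] = 1 ≤ x × x ≤ n

-- Positions are counted from 0 (by Fin), values from 1, so a bijection of
-- Fin n is written as a sequence by shifting its values up by one.

IsPermutation : Vec ℕ n → Set
IsPermutation {n} τ =
  Σ[ π ∈ Permutation′ n ] (∀ i → lookup τ i ≡ suc (toℕ (π ⟨$⟩ʳ i)))

_Contains_ : Vec ℕ m → Vec ℕ k → Set
_Contains_ {m} {k} τ σ =
  Σ[ i ∈ (Fin k → Fin m) ]
    (∀ a b → a Fin.< b → i a Fin.< i b) ×
    (∀ a b → a Fin.< b →
      (lookup τ (i a) < lookup τ (i b)) ⇔ (lookup σ a < lookup σ b))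

_Avoids_ : Vec ℕ m → Vec ℕ k → Set
τ Avoids σ = ¬ (τ Contains σ)

-- Only the relative order of the entries of a pattern is ever used.

Pattern : Set
Pattern = ∃ (Vec ℕ)

132-pattern 312-pattern : Vec ℕ 3
132-pattern = 1 ∷ 3 ∷ 2 ∷ []
312-pattern = 3 ∷ 1 ∷ 2 ∷ []

-- The set S_{n,(c₁,…,c_t)}(σ₁,…,σ_m), for t ≤ n.

S : ∀ n {t} → .(t ≤ n) → Vec ℕ t → List Pattern → Pred (Vec ℕ n) _
S n t≤n c σs τ =
  IsPermutation τ ×
  (∀ i → lookup τ (inject≤ i t≤n) ≡ lookup c i) ×
  List.All (λ (_ , σ) → τ Avoids σ) σs

-- For c with distinct entries.  As the entries are natural numbers, so is the
-- smallest one x (when t ≥ 1), and nothing is lost by not letting x and v range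
-- over all integers.

Consecutive : Vec ℕ t → Set
Consecutive {t} c = ∃[ x ] (∀ v → v ∈ c ⇔ (x ≤ v × v < x + t))

minimum : 1 ≤ t → Vec ℕ t → ℕ
minimum (s≤s _) c = foldr₁ _⊓_ c

-- P has exactly k elements: they can be listed without repetition in a list
-- of length k.  Such a k is unique.

∣_∣≐_ : {A : Set a} → Pred A p → ℕ → Set (a ⊔ p)
∣_∣≐_ {A = A} P k =
  Σ[ xs ∈ List A ] List.Unique xs × (∀ x → x List.∈ xs ⇔ P x) × length xs ≡ k

{-# OPTIONS --safe #-}
-- Avoiding 132 and 312 means that no entry lies strictly between two earlier
-- entries.  In a permutation of [n] this forces the entries of every prefix to
-- form an interval, so after a prefix with entries a+1, …, h the next entry is
-- either a or h+1.  Hence the completions of a consecutive prefix are the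
-- arrangements of the a remaining small entries among the n − t remaining
-- positions.
module Submission where

open import Defs
open import Data.List.Base using ([]; _∷_)
open import Data.Nat.Base using (ℕ; _∸_; _≤_; _<_; _≥_)
open import Data.Nat.Combinatorics using (_C_)
open import Data.Nat.Properties using (<⇒≤)
open import Data.Product.Base using (_×_; _,_)
open import Data.Vec.Base using (Vec)
open import Data.Vec.Relation.Unary.All using (All)
open import Data.Vec.Relation.Unary.Unique.Propositional using (Unique)
open import Relation.Nullary.Negation.Core using (¬_)

open import Data.Fin.Base as Fin using (Fin; zero; suc; toℕ; fromℕ<; inject≤; _↑ˡ_)
import Data.Fin.Permutation as Perm
open import Data.Fin.Properties
  using (toℕ<n; toℕ-fromℕ<; toℕ-injective; toℕ-inject≤; toℕ-↑ˡ)
open import Data.List.Base as List using (List; length)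
open import Data.List.Membership.Propositional using () renaming (_∈_ to _∈ₗ_)
import Data.List.Membership.Propositional.Properties as ListMem
open import Data.List.Properties using (length-map; length-++)
import Data.List.Relation.Unary.All as ListAll
import Data.List.Relation.Unary.AllPairs as ListAllPairs
import Data.List.Relation.Unary.Any as ListAny
import Data.List.Relation.Unary.Unique.Propositional as ListUnique
import Data.List.Relation.Unary.Unique.Propositional.Properties as ListUniqueProps
open import Data.Nat.Base using (zero; suc; pred; _+_; z≤n; s≤s; z<s; s<s)
open import Data.Nat.Combinatorics using (nCk+nC[k+1]≡[n+1]C[k+1])
open import Data.Nat.Solver using (module +-*-Solver)
open import Data.Nat.Properties as ℕ
  using (≤-refl; ≤-trans; ≤-antisym; <-asym;
         <-irrefl; <⇒≢; <⇒≱; <-cmp; ≮⇒≥; ≤∧≢⇒<; n<1+n; m≤n⇒m≤1+n; ≤-pred;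
         suc-injective; +-suc; +-identityʳ; m≤m+n; m<m+n; +-cancelʳ-≡;
         m+n∸m≡n; m≤n⇒∃[o]m+o≡n; _≟_)
open import Data.Product.Base using (proj₁; proj₂; ∃-syntax)
open import Data.Sum.Base using (_⊎_; inj₁; inj₂)
open import Data.Unit.Base using (⊤; tt)
open import Data.Vec.Base as Vec using ([]; _∷_; lookup; _++_)
open import Data.Vec.Membership.Propositional using (_∈_)
open import Data.Vec.Membership.Propositional.Properties
  using (∈-lookup; ∈-++⁺ˡ; ∈-++⁺ʳ)
open import Data.Vec.Properties
  using (lookup-++ˡ; tabulate∘lookup; tabulate-cong; ∷-injectiveˡ; ∷-injectiveʳ;
         ++-injectiveʳ)
open import Data.Vec.Relation.Unary.All as All using ([]; _∷_)
open import Data.Vec.Relation.Unary.AllPairs using (AllPairs; []; _∷_)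
import Data.Vec.Relation.Unary.AllPairs.Properties as AllPairs
open import Data.Vec.Relation.Unary.All.Properties using (lookup⁺; lookup⁻)
open import Data.Vec.Relation.Unary.Any as Any using (here; there)
open import Data.Vec.Relation.Unary.Any.Properties using (lookup-index; ++⁻)
open import Data.Vec.Relation.Unary.Unique.Propositional.Properties
  using (lookup-injective)
open import Function.Base using (_∘_; case_of_)
open import Function.Bundles using (_⇔_; mk⇔; Equivalence)
open import Level using (Level)
open import Relation.Binary.Core using (Rel)
open import Relation.Binary.Definitions using (tri<; tri≈; tri>)
open import Relation.Binary.PropositionalEquality
  using (_≡_; _≢_; refl; sym; trans; cong; cong₂; subst; module ≡-Reasoning)
open import Relation.Nullary using (yes; no; contradiction)

open +-*-Solver using (solve; con; _:+_; _:=_)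

private
  variable
    ℓ : Level
    A : Set ℓ
    a h k m n r s t v x y z : ℕ
    w : Vec ℕ r


-- Vectors read through their positions

allPairs-lookup⁺ : {R : Rel A ℓ} (xs : Vec A n) →
  (∀ i j → i Fin.< j → R (lookup xs i) (lookup xs j)) → AllPairs R xs
allPairs-lookup⁺ []       p = []
allPairs-lookup⁺ (x ∷ xs) p =
  lookup⁻ (λ j → p zero (suc j) z<s) ∷
  allPairs-lookup⁺ xs (λ i j i<j → p (suc i) (suc j) (s<s i<j))

allPairs-lookup⁻ : {R : Rel A ℓ} {xs : Vec A n} → AllPairs R xs →
  ∀ i j → i Fin.< j → R (lookup xs i) (lookup xs j)
allPairs-lookup⁻ (px ∷ _)  zero    (suc j) _         = lookup⁺ px j
allPairs-lookup⁻ (_ ∷ pxs) (suc i) (suc j) (s≤s i<j) = allPairs-lookup⁻ pxs i j i<j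

lookup-ext : {xs ys : Vec A n} → (∀ i → lookup xs i ≡ lookup ys i) → xs ≡ ys
lookup-ext {xs = xs} {ys} eq =
  trans (sym (tabulate∘lookup xs)) (trans (tabulate-cong eq) (tabulate∘lookup ys))

-- `S` addresses the prefix through `inject≤`, while lookups in a concatenation are stated for `↑ˡ`;
-- this passes from one to the other.
inject≤≡↑ˡ : .(t≤n : t ≤ t + r) (i : Fin t) → inject≤ i t≤n ≡ i ↑ˡ r
inject≤≡↑ˡ {r = r} t≤n i =
  toℕ-injective (trans (toℕ-inject≤ i t≤n) (sym (toℕ-↑ˡ i r)))

-- Pattern avoidance

-- For entries `x`, `y`, `z` that occur in this order, the first alternative is an occurrence of 132
-- and the second an occurrence of 312.
Between : ℕ → ℕ → ℕ → Set
Between x y z = (x < z × z < y) ⊎ (y < z × z < x)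

-- Here `x` may be any value placed before the whole vector, not only the entry directly before it;
-- later the two ends of an interval take this role.
Clear : ℕ → Vec ℕ m → Set
Clear x = AllPairs (λ y z → ¬ Between x y z)

NeverBetween : Vec ℕ m → Set
NeverBetween []       = ⊤
NeverBetween (x ∷ xs) = Clear x xs × NeverBetween xs

-- A pattern of length three has only three increasing pairs of positions, so three comparisons
-- determine an occurrence.
contains₃ : (τ : Vec ℕ m) (σ : Vec ℕ 3) {i j k : Fin m} → i Fin.< j → j Fin.< k →
  let p = lookup σ zero; q = lookup σ (suc zero); r = lookup σ (suc (suc zero)) in
  (lookup τ i < lookup τ j) ⇔ (p < q) →
  (lookup τ i < lookup τ k) ⇔ (p < r) →
  (lookup τ j < lookup τ k) ⇔ (q < r) →
  τ Contains σ
contains₃ {m} τ σ {i} {j} {k} i<j j<k ij ik jk = ι , mono , iff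
  where
  ι : Fin 3 → Fin m
  ι = lookup (i ∷ j ∷ k ∷ [])

  mono : ∀ a b → a Fin.< b → ι a Fin.< ι b
  mono zero       (suc zero)       _ = i<j
  mono zero       (suc (suc zero)) _ = ℕ.<-trans i<j j<k
  mono (suc zero) (suc (suc zero)) _ = j<k
  mono (suc zero)       (suc zero)       (s≤s ())
  mono (suc (suc zero)) (suc zero)       (s≤s ())
  mono (suc (suc zero)) (suc (suc zero)) (s≤s (s≤s ()))

  iff : ∀ a b → a Fin.< b →
    (lookup τ (ι a) < lookup τ (ι b)) ⇔ (lookup σ a < lookup σ b)
  iff zero       (suc zero)       _ = ij
  iff zero       (suc (suc zero)) _ = ik
  iff (suc zero) (suc (suc zero)) _ = jk
  iff (suc zero)       (suc zero)       (s≤s ())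
  iff (suc (suc zero)) (suc zero)       (s≤s ())
  iff (suc (suc zero)) (suc (suc zero)) (s≤s (s≤s ()))

private
  both : {P Q : Set} → P → Q → P ⇔ Q
  both p q = mk⇔ (λ _ → q) (λ _ → p)

  neither : {P Q : Set} → ¬ P → ¬ Q → P ⇔ Q
  neither ¬p ¬q = mk⇔ (λ p → contradiction p ¬p) (λ q → contradiction q ¬q)

avoids⇒¬between : (τ : Vec ℕ m) → τ Avoids 132-pattern → τ Avoids 312-pattern →
  {i j k : Fin m} → i Fin.< j → j Fin.< k →
  ¬ Between (lookup τ i) (lookup τ j) (lookup τ k)
avoids⇒¬between τ ¬132 ¬312 i<j j<k (inj₁ (i<ₜk , k<ₜj)) = ¬132
  (contains₃ τ 132-pattern i<j j<k
    (both (ℕ.<-trans i<ₜk k<ₜj) (s≤s (s≤s z≤n)))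
    (both i<ₜk (s≤s (s≤s z≤n)))
    (neither (<-asym k<ₜj) λ { (s≤s (s≤s ())) }))
avoids⇒¬between τ ¬132 ¬312 i<j j<k (inj₂ (j<ₜk , k<ₜi)) = ¬312
  (contains₃ τ 312-pattern i<j j<k
    (neither (<-asym (ℕ.<-trans j<ₜk k<ₜi)) λ { (s≤s ()) })
    (neither (<-asym k<ₜi) λ { (s≤s (s≤s ())) })
    (both j<ₜk (s≤s (s≤s z≤n))))

neverBetween-lookup⁺ : (τ : Vec ℕ m) →
  (∀ {i j k} → i Fin.< j → j Fin.< k →
    ¬ Between (lookup τ i) (lookup τ j) (lookup τ k)) →
  NeverBetween τ
neverBetween-lookup⁺ []       p = tt
neverBetween-lookup⁺ (x ∷ xs) p =
  allPairs-lookup⁺ xs (λ j k j<k → p {zero} {suc j} {suc k} z<s (s<s j<k)) ,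
  neverBetween-lookup⁺ xs (λ i<j j<k → p (s<s i<j) (s<s j<k))

neverBetween-lookup⁻ : (τ : Vec ℕ m) → NeverBetween τ →
  ∀ i j k → i Fin.< j → j Fin.< k →
  ¬ Between (lookup τ i) (lookup τ j) (lookup τ k)
neverBetween-lookup⁻ (x ∷ xs) (px , _) zero (suc j) (suc k) _ (s≤s j<k) =
  allPairs-lookup⁻ px j k j<k
neverBetween-lookup⁻ (x ∷ xs) (_ , pxs) (suc i) (suc j) (suc k) (s≤s i<j) (s≤s j<k) =
  neverBetween-lookup⁻ xs pxs i j k i<j j<k

avoids⇒neverBetween : (τ : Vec ℕ m) →
  τ Avoids 132-pattern → τ Avoids 312-pattern → NeverBetween τ
avoids⇒neverBetween τ ¬132 ¬312 =
  neverBetween-lookup⁺ τ (avoids⇒¬between τ ¬132 ¬312)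

-- Where the pattern descends, an occurrence only satisfies ≥; distinctness of
-- the entries makes the inequality strict.
module _ {τ : Vec ℕ m} (τ! : Unique τ) (nb : NeverBetween τ) where

  private
    ≮⇒> : {i j : Fin m} → i Fin.< j → ¬ lookup τ i < lookup τ j → lookup τ j < lookup τ i
    ≮⇒> i<j i≮ₜj = ≤∧≢⇒< (≮⇒≥ i≮ₜj)
      (λ eq → <⇒≢ i<j (cong toℕ (lookup-injective τ! _ _ (sym eq))))

  neverBetween⇒avoids-132 : τ Avoids 132-pattern
  neverBetween⇒avoids-132 (ι , mono , iff) =
    neverBetween-lookup⁻ τ nb _ _ _ 0<1 1<2
      (inj₁ ( Equivalence.from (iff zero (suc (suc zero)) z<s) (s≤s (s≤s z≤n))
            , ≮⇒> 1<2 λ lt → case Equivalence.to (iff (suc zero) (suc (suc zero)) (s<s z<s)) lt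
                of λ { (s≤s (s≤s ())) }))
    where
    0<1 = mono zero (suc zero) z<s
    1<2 = mono (suc zero) (suc (suc zero)) (s<s z<s)

  neverBetween⇒avoids-312 : τ Avoids 312-pattern
  neverBetween⇒avoids-312 (ι , mono , iff) =
    neverBetween-lookup⁻ τ nb _ _ _ 0<1 1<2
      (inj₂ ( Equivalence.from (iff (suc zero) (suc (suc zero)) (s<s z<s)) (s≤s (s≤s z≤n))
            , ≮⇒> (mono zero (suc (suc zero)) z<s)
                λ lt → case Equivalence.to (iff zero (suc (suc zero)) z<s) lt
                of λ { (s≤s (s≤s ())) }))
    where
    0<1 = mono zero (suc zero) z<s
    1<2 = mono (suc zero) (suc (suc zero)) (s<s z<s)

-- Permutations of [n]

module _ (τ : Vec ℕ n) where

  permutation-unique : IsPermutation τ → Unique τ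
  permutation-unique (π , τ≗π) = allPairs-lookup⁺ τ λ i j i<j eq →
    <⇒≢ i<j (cong toℕ (trans (sym (Perm.inverseˡ π))
      (trans (cong (π Perm.⟨$⟩ˡ_) (πi≡πj eq)) (Perm.inverseˡ π))))
    where
    πi≡πj : ∀ {i j} → lookup τ i ≡ lookup τ j → π Perm.⟨$⟩ʳ i ≡ π Perm.⟨$⟩ʳ j
    πi≡πj eq = toℕ-injective (suc-injective (trans (sym (τ≗π _)) (trans eq (τ≗π _))))

  permutation-bounds : IsPermutation τ → v ∈ τ → v ∈[1⋯ n ]
  permutation-bounds (π , τ≗π) v∈τ =
    subst (_∈[1⋯ n ]) (sym (trans (lookup-index v∈τ) (τ≗π _))) (s≤s z≤n , toℕ<n _)

  permutation-complete : IsPermutation τ → v ∈[1⋯ n ] → v ∈ τ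
  permutation-complete {v = suc v} (π , τ≗π) (_ , v<n) = subst (_∈ τ) eq (∈-lookup i τ)
    where
    open ≡-Reasoning
    i = π Perm.⟨$⟩ˡ fromℕ< v<n
    eq : lookup τ i ≡ suc v
    eq = begin
      lookup τ i                   ≡⟨ τ≗π i ⟩
      suc (toℕ (π Perm.⟨$⟩ʳ i))     ≡⟨ cong (suc ∘ toℕ) (Perm.inverseʳ π) ⟩
      suc (toℕ (fromℕ< v<n))       ≡⟨ cong suc (toℕ-fromℕ< v<n) ⟩
      suc v                        ∎

  -- The inverse sends a value to the position where `complete` finds it; distinctness of the
  -- entries makes that position the only one.
  isPermutation : Unique τ → (∀ {v} → v ∈ τ → v ∈[1⋯ n ]) →
    (∀ {v} → v ∈[1⋯ n ] → v ∈ τ) → IsPermutation τ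
  isPermutation τ! bounds complete = Perm.permutation f g f∘g g∘f , τ≗f
    where

    suc-pred≡ : v ∈[1⋯ n ] → suc (pred v) ≡ v
    suc-pred≡ (s≤s _ , _) = refl

    bound : ∀ i → lookup τ i ∈[1⋯ n ]
    bound i = bounds (∈-lookup i τ)

    pred<n : ∀ i → pred (lookup τ i) < n
    pred<n i = subst (_≤ n) (sym (suc-pred≡ (bound i))) (proj₂ (bound i))

    f : Fin n → Fin n
    f i = fromℕ< (pred<n i)

    τ≗f : ∀ i → lookup τ i ≡ suc (toℕ (f i))
    τ≗f i = sym (trans (cong suc (toℕ-fromℕ< (pred<n i))) (suc-pred≡ (bound i)))

    position : ∀ j → suc (toℕ j) ∈ τ
    position j = complete (s≤s z≤n , toℕ<n j)

    g : Fin n → Fin n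
    g j = Any.index (position j)

    f∘g : ∀ j → f (g j) ≡ j
    f∘g j = toℕ-injective (suc-injective
      (trans (sym (τ≗f (g j))) (sym (lookup-index (position j)))))

    g∘f : ∀ i → g (f i) ≡ i
    g∘f i = lookup-injective τ! _ _
      (trans (sym (lookup-index (position (f i)))) (sym (τ≗f i)))

-- Completions of a prefix with entries a+1, …, h

-- The values a+1, ..., h count as used, and each entry of `w` extends this interval by one at its
-- lower or upper end until it is all of [n]. This is a lattice path with `r` steps, `a` of them
-- down.
data Path (n : ℕ) : (a h : ℕ) → Vec ℕ r → Set where
  done : Path n 0 n []
  down : Path n a h w → Path n (suc a) h (suc a ∷ w)
  up   : Path n a (suc h) w → Path n a h (suc h ∷ w)

Outside : (n a h v : ℕ) → Set
Outside n a h v = (1 ≤ v × v ≤ a) ⊎ (h < v × v ≤ n)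

-- An interval is convex: a value between two of its members belongs to it.
outside⇒¬between : a < x → x ≤ h → a < y → y ≤ h → Outside n a h z → ¬ Between x y z
outside⇒¬between a<x x≤h a<y y≤h (inj₁ (_ , z≤a)) (inj₁ (x<z , _)) =
  <⇒≱ (ℕ.<-trans a<x x<z) z≤a
outside⇒¬between a<x x≤h a<y y≤h (inj₁ (_ , z≤a)) (inj₂ (y<z , _)) =
  <⇒≱ (ℕ.<-trans a<y y<z) z≤a
outside⇒¬between a<x x≤h a<y y≤h (inj₂ (h<z , _)) (inj₁ (_ , z<y)) =
  <⇒≱ (ℕ.<-trans h<z z<y) y≤h
outside⇒¬between a<x x≤h a<y y≤h (inj₂ (h<z , _)) (inj₂ (_ , z<x)) =
  <⇒≱ (ℕ.<-trans h<z z<x) x≤h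

path-h≤n : Path n a h w → h ≤ n
path-h≤n done     = ≤-refl
path-h≤n (down p) = path-h≤n p
path-h≤n (up p)   = <⇒≤ (path-h≤n p)

path-outside : Path n a h w → v ∈ w → Outside n a h v
path-outside (down p) (here refl) = inj₁ (s≤s z≤n , ≤-refl)
path-outside (down p) (there v∈w) with path-outside p v∈w
... | inj₁ (1≤v , v≤a) = inj₁ (1≤v , m≤n⇒m≤1+n v≤a)
... | inj₂ h<v≤n       = inj₂ h<v≤n
path-outside (up p) (here refl) = inj₂ (≤-refl , path-h≤n p)
path-outside (up p) (there v∈w) with path-outside p v∈w
... | inj₁ 1≤v≤a       = inj₁ 1≤v≤a
... | inj₂ (h<v , v≤n) = inj₂ (<⇒≤ h<v , v≤n)

path-complete : Path n a h w → v ∈[1⋯ n ] → (a < v × v ≤ h) ⊎ v ∈ w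
path-complete done 1≤v≤n = inj₁ 1≤v≤n
path-complete {v = v} (down {a = a} p) 1≤v≤n with path-complete p 1≤v≤n
... | inj₂ v∈w = inj₂ (there v∈w)
... | inj₁ (a<v , v≤h) with v ≟ suc a
...   | yes v≡ = inj₂ (here v≡)
...   | no  v≢ = inj₁ (≤∧≢⇒< a<v (v≢ ∘ sym) , v≤h)
path-complete {v = v} (up {h = h} p) 1≤v≤n with path-complete p 1≤v≤n
... | inj₂ v∈w = inj₂ (there v∈w)
... | inj₁ (a<v , v≤1+h) with v ≟ suc h
...   | yes v≡ = inj₂ (here v≡)
...   | no  v≢ = inj₁ (a<v , ≤-pred (≤∧≢⇒< v≤1+h v≢))

∉⇒All≢ : (∀ {v} → v ∈ w → x ≢ v) → All (x ≢_) w
∉⇒All≢ {w = w} p = lookup⁻ (λ i → p (∈-lookup i w))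

outside⇒≢ : a < x → x ≤ h → Outside n a h v → x ≢ v
outside⇒≢ a<x x≤h (inj₁ (_ , v≤a)) refl = <⇒≱ a<x v≤a
outside⇒≢ a<x x≤h (inj₂ (h<v , _)) refl = <⇒≱ h<v x≤h

path-unique : Path n a h w → a ≤ h → Unique w
path-unique done     _   = []
path-unique (down p) a≤h =
  ∉⇒All≢ (outside⇒≢ ≤-refl a≤h ∘ path-outside p) ∷ path-unique p (<⇒≤ a≤h)
path-unique (up p)   a≤h =
  ∉⇒All≢ (outside⇒≢ (s≤s a≤h) ≤-refl ∘ path-outside p) ∷ path-unique p (m≤n⇒m≤1+n a≤h)

all-outside : Path n a h w → All (Outside n a h) w
all-outside {w = w} p = lookup⁻ (λ i → path-outside p (∈-lookup i w))

-- Each entry `y` of `w` enlarges the interval to one that contains both `x` and `y`. All entries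
-- after `y` lie outside the enlarged interval, so convexity applies.
path-clear : Path n a h w → a < x → x ≤ h → Clear x w
path-clear done a<x x≤h = []
path-clear (down p) a<x x≤h =
  All.map (outside⇒¬between (<⇒≤ a<x) x≤h ≤-refl (≤-trans (<⇒≤ a<x) x≤h)) (all-outside p) ∷
  path-clear p (<⇒≤ a<x) x≤h
path-clear (up p) a<x x≤h =
  All.map (outside⇒¬between a<x (m≤n⇒m≤1+n x≤h) (m≤n⇒m≤1+n (≤-trans a<x x≤h)) ≤-refl)
    (all-outside p) ∷
  path-clear p a<x (m≤n⇒m≤1+n x≤h)

path-neverBetween : Path n a h w → a ≤ h → NeverBetween w
path-neverBetween done     _   = tt
path-neverBetween (down p) a≤h =
  path-clear p ≤-refl a≤h , path-neverBetween p (<⇒≤ a≤h)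
path-neverBetween (up p)   a≤h =
  path-clear p (s≤s a≤h) ≤-refl , path-neverBetween p (m≤n⇒m≤1+n a≤h)

neverBetween-++-path : (u : Vec ℕ s) → NeverBetween u →
  (∀ {x} → x ∈ u → a < x × x ≤ h) → a ≤ h → Path n a h w → NeverBetween (u ++ w)
neverBetween-++-path [] _ _ a≤h p = path-neverBetween p a≤h
neverBetween-++-path (x ∷ u) (clear , nb) inside a≤h p =
  -- The two entries that follow `x` may both lie in `u`, both in `w`, or one in each; only the last
  -- case uses convexity directly.
  AllPairs.++⁺ clear (path-clear p a<x x≤h) (lookup⁻ λ i →
    let a<y , y≤h = inside (there (∈-lookup i u)) in
    All.map (outside⇒¬between a<x x≤h a<y y≤h) (all-outside p)) ,
  neverBetween-++-path u nb (inside ∘ there) a≤h p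
  where
  a<x = proj₁ (inside (here refl))
  x≤h = proj₂ (inside (here refl))

-- If the next entry y skipped the neighbour of an end of the interval, that
-- neighbour would come later and lie between this end and y.
next-entry : All (λ z → ¬ Between (suc a) y z) w → All (λ z → ¬ Between h y z) w →
  Outside n a h y → (∀ {v} → Outside n a h v → v ∈ y ∷ w) →
  (y ≡ a × 1 ≤ a) ⊎ y ≡ suc h
next-entry {a} {y} lo hi (inj₁ (1≤y , y≤a)) complete with y ≟ a
... | yes refl = inj₁ (refl , 1≤y)
... | no  y≢a with complete (inj₁ (≤-trans 1≤y y≤a , ≤-refl))
...   | here a≡y = contradiction (sym a≡y) y≢a
...   | there a∈w = contradiction (inj₂ (≤∧≢⇒< y≤a y≢a , n<1+n a)) (All.lookup lo a∈w)
next-entry {y = y} {h = h} lo hi (inj₂ (h<y , y≤n)) complete with suc h ≟ y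
... | yes refl = inj₂ refl
... | no  1+h≢y with complete (inj₂ (n<1+n h , ≤-trans h<y y≤n))
...   | here 1+h≡y = contradiction 1+h≡y 1+h≢y
...   | there 1+h∈w =
  contradiction (inj₁ (n<1+n h , ≤∧≢⇒< h<y 1+h≢y)) (All.lookup hi 1+h∈w)

-- Induction on `w`. Of the earlier entries only the two ends `suc a` and `h` of the interval have
-- to be remembered: the next entry becomes the new end on its side, and the other end stays.
neverBetween⇒path : (w : Vec ℕ r) → Unique w → NeverBetween w →
  a < h → h ≤ n → Clear (suc a) w → Clear h w →
  (∀ {v} → v ∈ w → Outside n a h v) → (∀ {v} → Outside n a h v → v ∈ w) →
  Path n a h w
-- An empty `w` leaves no value outside the interval: a positive lower bound would itself be
-- missing, and in the next clause `suc h` would be missing if `h` were less than `n`.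
neverBetween⇒path {a = suc a} [] _ _ _ _ _ _ _ complete
  with () ← complete (inj₁ (s≤s z≤n , ≤-refl))
neverBetween⇒path {a = zero} {h} {n} [] _ _ _ h≤n _ _ _ complete with h ≟ n
... | yes refl = done
... | no  h≢n  with () ← complete (inj₂ (n<1+n h , ≤∧≢⇒< h≤n h≢n))
neverBetween⇒path {a = a} {h} {n} (y ∷ w) (y∉w ∷ w!) (clear-y , nb) a<h h≤n
  (lo ∷ clear-lo) (hi ∷ clear-hi) outside complete
  with next-entry lo hi (outside (here refl)) complete
-- Matching on `1 ≤ a` writes the lower bound as a successor, the form that `down` requires.
... | inj₁ (refl , s≤s {n = a′} z≤n) =
  down (neverBetween⇒path w w! nb (<⇒≤ a<h) h≤n clear-y clear-hi outside′ complete′)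
  where
  outside′ : v ∈ w → Outside n a′ h v
  outside′ v∈w with outside (there v∈w)
  ... | inj₁ (1≤v , v≤a) =
    inj₁ (1≤v , ≤-pred (≤∧≢⇒< v≤a (All.lookup y∉w v∈w ∘ sym)))
  ... | inj₂ h<v≤n       = inj₂ h<v≤n

  complete′ : Outside n a′ h v → v ∈ w
  complete′ (inj₁ (1≤v , v≤a′)) with complete (inj₁ (1≤v , m≤n⇒m≤1+n v≤a′))
  ... | here refl = contradiction v≤a′ (<-irrefl refl)
  ... | there v∈w = v∈w
  complete′ (inj₂ (h<v , v≤n)) with complete (inj₂ (h<v , v≤n))
  ... | here refl = contradiction h<v (<-asym a<h)
  ... | there v∈w = v∈w
... | inj₂ refl =
  up (neverBetween⇒path w w! nb (m≤n⇒m≤1+n a<h) 1+h≤n clear-lo clear-y outside′ complete′)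
  where
  1+h≤n : suc h ≤ n
  1+h≤n with outside (here refl)
  ... | inj₁ (_ , 1+h≤a) = contradiction (<⇒≤ a<h) (<⇒≱ 1+h≤a)
  ... | inj₂ (_ , 1+h≤n) = 1+h≤n

  outside′ : v ∈ w → Outside n a (suc h) v
  outside′ v∈w with outside (there v∈w)
  ... | inj₁ 1≤v≤a       = inj₁ 1≤v≤a
  ... | inj₂ (h<v , v≤n) = inj₂ (≤∧≢⇒< h<v (All.lookup y∉w v∈w) , v≤n)

  complete′ : Outside n a (suc h) v → v ∈ w
  complete′ (inj₁ (1≤v , v≤a)) with complete (inj₁ (1≤v , v≤a))
  ... | here refl = contradiction (<⇒≤ a<h) (<⇒≱ v≤a)
  ... | there v∈w = v∈w
  complete′ (inj₂ (1+h<v , v≤n)) with complete (inj₂ (<⇒≤ 1+h<v , v≤n))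
  ... | here refl = contradiction 1+h<v (<-irrefl refl)
  ... | there v∈w = v∈w

-- The prefix u extends the interval (a, h] to (a′, h′].
path-split : (u : Vec ℕ s) → Path n a h (u ++ w) → a ≤ h →
  ∃[ a′ ] ∃[ h′ ] Path n a′ h′ w × h′ + a ≡ h + s + a′ ×
    (∀ v → ((a < v × v ≤ h) ⊎ v ∈ u) ⇔ (a′ < v × v ≤ h′))
path-split {a = a} {h} [] p _ =
  a , h , p , cong (_+ a) (sym (+-identityʳ h)) ,
  λ v → mk⇔ (λ { (inj₁ q) → q ; (inj₂ ()) }) inj₁
path-split {s = suc s} (_ ∷ u) (down {a = a} {h = h} p) a≤h
  with a′ , h′ , p′ , eq , iff ← path-split u p (<⇒≤ a≤h) =
  a′ , h′ , p′ ,
  trans (+-suc h′ a) (trans (cong suc eq) (cong (_+ a′) (sym (+-suc h s)))) ,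
  λ v → mk⇔
    (λ { (inj₁ (a<v , v≤h)) → Equivalence.to (iff v) (inj₁ (<⇒≤ a<v , v≤h))
       ; (inj₂ (here refl)) → Equivalence.to (iff v) (inj₁ (≤-refl , a≤h))
       ; (inj₂ (there v∈u)) → Equivalence.to (iff v) (inj₂ v∈u) })
    (λ q → case Equivalence.from (iff v) q of λ
       { (inj₁ (a<v , v≤h)) → case v ≟ suc a of λ
           { (yes v≡) → inj₂ (here v≡)
           ; (no  v≢) → inj₁ (≤∧≢⇒< a<v (v≢ ∘ sym) , v≤h) }
       ; (inj₂ v∈u) → inj₂ (there v∈u) })
path-split {s = suc s} {a = a} {h} (_ ∷ u) (up p) a≤h
  with a′ , h′ , p′ , eq , iff ← path-split u p (m≤n⇒m≤1+n a≤h) =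
  a′ , h′ , p′ , trans eq (cong (_+ a′) (sym (+-suc h s))) ,
  λ v → mk⇔
    (λ { (inj₁ (a<v , v≤h)) → Equivalence.to (iff v) (inj₁ (a<v , m≤n⇒m≤1+n v≤h))
       ; (inj₂ (here refl)) → Equivalence.to (iff v) (inj₁ (s≤s a≤h , ≤-refl))
       ; (inj₂ (there v∈u)) → Equivalence.to (iff v) (inj₂ v∈u) })
    (λ q → case Equivalence.from (iff v) q of λ
       { (inj₁ (a<v , v≤1+h)) → case v ≟ suc h of λ
           { (yes v≡) → inj₂ (here v≡)
           ; (no  v≢) → inj₁ (a<v , ≤-pred (≤∧≢⇒< v≤1+h v≢)) }
       ; (inj₂ v∈u) → inj₂ (there v∈u) })

-- Enumeration of the completions

-- Splitting on the first entry gives Pascal's recursion in `r` and `a`. The size n of the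
-- permutation does not appear, since it is h + r - a.
paths : (r a h : ℕ) → List (Vec ℕ r)
paths zero    zero    h = [] ∷ []
paths zero    (suc a) h = []
paths (suc r) zero    h = List.map (suc h ∷_) (paths r zero (suc h))
paths (suc r) (suc a) h =
  List.map (suc a ∷_) (paths r a h) List.++ List.map (suc h ∷_) (paths r (suc a) (suc h))

length-paths : ∀ r a h → length (paths r a h) ≡ r C a
length-paths zero    zero    h = refl
length-paths zero    (suc a) h = refl
length-paths (suc r) zero    h =
  trans (length-map _ (paths r zero (suc h))) (length-paths r zero (suc h))
length-paths (suc r) (suc a) h = begin
  length (List.map (suc a ∷_) (paths r a h) List.++ _)
    ≡⟨ length-++ (List.map (suc a ∷_) (paths r a h)) ⟩
  length (List.map (suc a ∷_) (paths r a h)) + _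
    ≡⟨ cong₂ _+_ (length-map _ (paths r a h)) (length-map _ (paths r (suc a) (suc h))) ⟩
  length (paths r a h) + length (paths r (suc a) (suc h))
    ≡⟨ cong₂ _+_ (length-paths r a h) (length-paths r (suc a) (suc h)) ⟩
  r C a + r C suc a
    ≡⟨ nCk+nC[k+1]≡[n+1]C[k+1] r a ⟩
  suc r C suc a ∎
  where open ≡-Reasoning

paths-unique : ∀ r a h → a ≤ h → ListUnique.Unique (paths r a h)
paths-unique zero    zero    h _ = ListAll.[] ListAllPairs.∷ ListAllPairs.[]
paths-unique zero    (suc a) h _ = ListAllPairs.[]
paths-unique (suc r) zero    h _ =
  ListUniqueProps.map⁺ ∷-injectiveʳ (paths-unique r zero (suc h) z≤n)
paths-unique (suc r) (suc a) h a<h = ListUniqueProps.++⁺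
  (ListUniqueProps.map⁺ ∷-injectiveʳ (paths-unique r a h (<⇒≤ a<h)))
  (ListUniqueProps.map⁺ ∷-injectiveʳ (paths-unique r (suc a) (suc h) (m≤n⇒m≤1+n a<h)))
  -- The two halves are disjoint because their vectors start with `suc a` and `suc h`, and the lower
  -- bound `suc a` is at most `h`.
  λ (w∈down , w∈up) →
    let _ , _ , w≡down = ListMem.∈-map⁻ _ w∈down
        _ , _ , w≡up   = ListMem.∈-map⁻ _ w∈up
    in <⇒≢ (s≤s a<h) (∷-injectiveˡ (trans (sym w≡down) w≡up))

path⇒∈paths : Path n a h w → w ∈ₗ paths _ a h
path⇒∈paths done                = ListAny.here refl
path⇒∈paths (down p)            = ListMem.∈-++⁺ˡ (ListMem.∈-map⁺ _ (path⇒∈paths p))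
-- The case split on `a` follows the two recursive clauses of `paths`: upward steps form the whole
-- list for 0 and its second half otherwise.
path⇒∈paths {a = zero}  (up p)  = ListMem.∈-map⁺ _ (path⇒∈paths p)
path⇒∈paths {a = suc _} (up p)  = ListMem.∈-++⁺ʳ _ (ListMem.∈-map⁺ _ (path⇒∈paths p))

-- The equation says that the `r` free positions hold the `a` small and n - h large missing values;
-- at the end of the path it forces `h` to be `n`.
∈paths⇒path : ∀ r a h {w : Vec ℕ r} → h + r ≡ a + n → w ∈ₗ paths r a h → Path n a h w
∈paths⇒path zero zero h eq (ListAny.here refl) with refl ← trans (sym eq) (+-identityʳ h) = done
∈paths⇒path (suc r) zero h eq w∈
  with _ , w∈′ , refl ← ListMem.∈-map⁻ _ w∈ =
  up (∈paths⇒path r zero (suc h) (trans (sym (+-suc h r)) eq) w∈′)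
∈paths⇒path (suc r) (suc a) h eq w∈
  with ListMem.∈-++⁻ (List.map (suc a ∷_) (paths r a h)) w∈
... | inj₁ w∈down with _ , w∈′ , refl ← ListMem.∈-map⁻ _ w∈down =
  down (∈paths⇒path r a h (suc-injective (trans (sym (+-suc h r)) eq)) w∈′)
... | inj₂ w∈up with _ , w∈′ , refl ← ListMem.∈-map⁻ _ w∈up =
  up (∈paths⇒path r (suc a) (suc h) (trans (sym (+-suc h r)) eq) w∈′)

-- The minimum of a vector

minimum-∈ : (1≤t : 1 ≤ t) (c : Vec ℕ t) → minimum 1≤t c ∈ c
minimum-∈ (s≤s _) (x ∷ [])     = here refl
minimum-∈ (s≤s _) (x ∷ y ∷ c)
  with minimum-∈ (s≤s z≤n) (y ∷ c) | ℕ.⊓-sel x (minimum (s≤s z≤n) (y ∷ c))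
... | _  | inj₁ eq = here eq
... | ∈c | inj₂ eq = there (subst (_∈ y ∷ c) (sym eq) ∈c)

minimum-≤ : (1≤t : 1 ≤ t) (c : Vec ℕ t) → v ∈ c → minimum 1≤t c ≤ v
minimum-≤ (s≤s _) (x ∷ [])    (here refl)  = ≤-refl
minimum-≤ (s≤s _) (x ∷ y ∷ c) (here refl)  = ℕ.m⊓n≤m x _
minimum-≤ (s≤s _) (x ∷ y ∷ c) (there v∈c) =
  ≤-trans (ℕ.m⊓n≤n x _) (minimum-≤ (s≤s z≤n) (y ∷ c) v∈c)


-- Permutations with a given prefix

permutation⇒path : {w : Vec ℕ m} → IsPermutation (suc a ∷ w) →
  NeverBetween (suc a ∷ w) → Path (suc m) a (suc a) w
permutation⇒path {m} {a} {w} π (clear , nb) with permutation-unique (suc a ∷ w) π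
... | a∉w ∷ w! =
  -- The path starts from a one-element interval, whose only entry is both its lower and its upper
  -- end; hence `clear` occurs twice.
  neverBetween⇒path w w! nb ≤-refl 1+a≤n clear clear outside complete
  where
  1+a≤n : suc a ≤ suc m
  1+a≤n = proj₂ (permutation-bounds (_ ∷ _) π (here refl))

  outside : v ∈ w → Outside (suc m) a (suc a) v
  outside {v} v∈w with permutation-bounds (_ ∷ _) π (there v∈w) | <-cmp (suc a) v
  ... | 1≤v , v≤n | tri< a<v _ _ = inj₂ (a<v , v≤n)
  ... | 1≤v , v≤n | tri≈ _ a≡v _ = contradiction a≡v (All.lookup a∉w v∈w)
  ... | 1≤v , v≤n | tri> _ _ v<a = inj₁ (1≤v , ≤-pred v<a)

  complete : Outside (suc m) a (suc a) v → v ∈ w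
  complete (inj₁ (1≤v , v≤a))
    with permutation-complete (_ ∷ _) π (1≤v , ≤-trans v≤a (<⇒≤ 1+a≤n))
  ... | here refl = contradiction v≤a (<-irrefl refl)
  ... | there v∈w = v∈w
  complete (inj₂ (a<v , v≤n)) with permutation-complete (_ ∷ _) π (≤-trans (s≤s z≤n) a<v , v≤n)
  ... | here refl = contradiction a<v (<-irrefl refl)
  ... | there v∈w = v∈w

-- The interval is half-open, so `a` is the number of positive values below it and becomes the lower
-- index of the binomial coefficient.
IsInterval : ℕ → Vec ℕ t → Set
IsInterval {t} a c = ∀ v → v ∈ c ⇔ (a < v × v ≤ a + t)

-- The path is built from the first entry of `c` onwards and then cut where `c` ends; the cut shows
-- that the entries of `c` fill an interval.
permutation-++⇒path : 1 ≤ t → (c : Vec ℕ t) {w : Vec ℕ r} →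
  IsPermutation (c ++ w) → NeverBetween (c ++ w) →
  ∃[ a ] IsInterval a c × Path (t + r) a (a + t) w
-- The bound `1 ≤ x` rules out a first entry 0, so the next clause can write it as `suc b`.
permutation-++⇒path (s≤s _) (x ∷ c) π nb with permutation-bounds (_ ∷ _) π (here refl)
permutation-++⇒path {t = suc s} {r} (s≤s _) (suc b ∷ c) {w} π nb | _
  with a , h , p , eq , iff ← path-split c (permutation⇒path π nb) (<⇒≤ (n<1+n b)) =
  a , interval , subst (λ h → Path _ a h w) h≡a+t p
  where
  open ≡-Reasoning
  -- The length equation of `path-split`, for the initial interval from `b` to `suc b`, is free of
  -- subtraction; cancelling `b` gives the upper end.
  h≡a+t : h ≡ a + suc s
  h≡a+t = +-cancelʳ-≡ b _ _ (begin
    h + b            ≡⟨ eq ⟩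
    suc b + s + a    ≡⟨ solve 3 (λ a b s → con 1 :+ b :+ s :+ a := a :+ (con 1 :+ s) :+ b)
                          refl a b s ⟩
    a + suc s + b    ∎)

  interval : IsInterval a (suc b ∷ c)
  interval v rewrite sym h≡a+t = mk⇔
    (λ { (here refl)  → Equivalence.to (iff v) (inj₁ (≤-refl , ≤-refl))
       ; (there v∈c) → Equivalence.to (iff v) (inj₂ v∈c) })
    (λ q → case Equivalence.from (iff v) q of λ
       { (inj₁ (b<v , v≤1+b)) → here (≤-antisym v≤1+b b<v)
       ; (inj₂ v∈c)           → there v∈c })

++-path-unique : {c : Vec ℕ t} → Unique c → IsInterval a c → Path n a (a + t) w →
  Unique (c ++ w)
++-path-unique {t} {a} {c = c} c! int p =
  AllPairs.++⁺ c! (path-unique p (m≤m+n a t)) (lookup⁻ λ i →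
    let a<x , x≤h = Equivalence.to (int _) (∈-lookup i c) in
    ∉⇒All≢ (outside⇒≢ a<x x≤h ∘ path-outside p))

path⇒permutation : (c : Vec ℕ t) {w : Vec ℕ r} → Unique c → IsInterval a c →
  Path (t + r) a (a + t) w → IsPermutation (c ++ w)
path⇒permutation {t} {r} {a} c {w} c! int p =
  isPermutation (c ++ w) (++-path-unique c! int p) bounds complete
  where
  bounds : v ∈ c ++ w → v ∈[1⋯ t + r ]
  bounds v∈ with ++⁻ c v∈
  ... | inj₁ v∈c =
    let a<v , v≤h = Equivalence.to (int _) v∈c in
    ≤-trans (s≤s z≤n) a<v , ≤-trans v≤h (path-h≤n p)
  ... | inj₂ v∈w with path-outside p v∈w
  ...   | inj₁ (1≤v , v≤a) = 1≤v , ≤-trans v≤a (≤-trans (m≤m+n a t) (path-h≤n p))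
  ...   | inj₂ (h<v , v≤n) = ≤-trans (s≤s z≤n) h<v , v≤n

  complete : v ∈[1⋯ t + r ] → v ∈ c ++ w
  complete v≤n with path-complete p v≤n
  ... | inj₁ q   = ∈-++⁺ˡ (Equivalence.from (int _) q)
  ... | inj₂ v∈w = ∈-++⁺ʳ c v∈w

-- This makes `a` a function of `c`: two intervals found for the same prefix coincide, and `a` is
-- the lower index in the formula.
isInterval-minimum : (1≤t : 1 ≤ t) (c : Vec ℕ t) → IsInterval a c → minimum 1≤t c ≡ suc a
isInterval-minimum {a = a} 1≤t c int = ≤-antisym
  (minimum-≤ 1≤t c (Equivalence.from (int (suc a)) (≤-refl , m<m+n a 1≤t)))
  (proj₁ (Equivalence.to (int _) (minimum-∈ 1≤t c)))

isInterval⇒consecutive : {c : Vec ℕ t} → IsInterval a c → Consecutive c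
isInterval⇒consecutive {a = a} int = suc a , λ v → mk⇔
  (λ v∈c → let a<v , v≤h = Equivalence.to (int v) v∈c in a<v , s≤s v≤h)
  (λ (a<v , v<h) → Equivalence.from (int v) (a<v , ≤-pred v<h))

consecutive⇒isInterval : 1 ≤ t → {c : Vec ℕ t} → All (1 ≤_) c → Consecutive c →
  ∃[ a ] IsInterval a c
consecutive⇒isInterval 1≤t 1≤c (x , iff)
  -- As t ≥ 1, the starting point `x` is itself an entry of `c`, hence positive, and `a` is its
  -- predecessor.
  with All.lookup 1≤c (Equivalence.from (iff x) (≤-refl , m<m+n x 1≤t))
... | s≤s {n = a} z≤n = a , λ v → mk⇔
  (λ v∈c → let a<v , v<h = Equivalence.to (iff v) v∈c in a<v , ≤-pred v<h)
  (λ (a<v , v≤h) → Equivalence.from (iff v) (a<v , s≤s v≤h))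

-- Counting the permutations of [t + r] that extend `c`

module _ {t r : ℕ} (1≤t : 1 ≤ t) .(t≤n : t ≤ t + r) (c : Vec ℕ t) where

  private
    S[132,312] : Vec ℕ (t + r) → Set
    S[132,312] = S (t + r) t≤n c ((3 , 132-pattern) ∷ (3 , 312-pattern) ∷ [])

  S⇒path : ∀ τ → S[132,312] τ →
    ∃[ w ] τ ≡ c ++ w × ∃[ a ] IsInterval a c × Path (t + r) a (a + t) w
  S⇒path τ (π , prefix , ¬132 ListAll.∷ ¬312 ListAll.∷ ListAll.[])
    with u , w , refl ← Vec.splitAt t τ
    with refl ← lookup-ext {xs = u} {c} (λ i →
      trans (sym (lookup-++ˡ u w i))
            (trans (cong (lookup (u ++ w)) (sym (inject≤≡↑ˡ t≤n i))) (prefix i))) =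
    w , refl ,
    permutation-++⇒path 1≤t c π (avoids⇒neverBetween (c ++ w) ¬132 ¬312)

  path⇒S : Unique c → NeverBetween c → IsInterval a c →
    Path (t + r) a (a + t) w → S[132,312] (c ++ w)
  path⇒S {a = a} {w = w} c! nb int p =
    path⇒permutation c c! int p ,
    (λ i → trans (cong (lookup (c ++ w)) (inject≤≡↑ˡ t≤n i)) (lookup-++ˡ c w i)) ,
    neverBetween⇒avoids-132 τ! τ-nb ListAll.∷ neverBetween⇒avoids-312 τ! τ-nb ListAll.∷ ListAll.[]
    where
    τ! = ++-path-unique c! int p
    τ-nb = neverBetween-++-path c nb (Equivalence.to (int _)) (m≤m+n a t) p

  count-consecutive : Unique c → NeverBetween c → IsInterval a c → ∣ S[132,312] ∣≐ (r C a)
  count-consecutive {a = a} c! nb int =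
    List.map (c ++_) (paths r a (a + t)) ,
    ListUniqueProps.map⁺ (++-injectiveʳ c c) (paths-unique r a (a + t) (m≤m+n a t)) ,
    (λ τ → mk⇔ (sound τ) (complete τ)) ,
    trans (length-map _ (paths r a (a + t))) (length-paths r a (a + t))
    where
    sound : ∀ τ → τ ∈ₗ List.map (c ++_) (paths r a (a + t)) → S[132,312] τ
    sound τ τ∈ with _ , w∈ , refl ← ListMem.∈-map⁻ _ τ∈ =
      path⇒S c! nb int (∈paths⇒path r a (a + t) (ℕ.+-assoc a t r) w∈)

    complete : ∀ τ → S[132,312] τ → τ ∈ₗ List.map (c ++_) (paths r a (a + t))
    complete τ τ∈S with w , refl , b , int′ , p ← S⇒path τ τ∈S
      -- The interval obtained from the completion is the given one, since both start at the minimum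
      -- of `c`.
      with refl ← suc-injective (trans (sym (isInterval-minimum 1≤t c int′))
                                       (isInterval-minimum 1≤t c int)) =
      ListMem.∈-map⁺ _ (path⇒∈paths p)

  count-¬consecutive : ¬ Consecutive c → ∣ S[132,312] ∣≐ 0
  count-¬consecutive ¬con = [] , ListAllPairs.[] ,
    -- Any member of the set would exhibit the entries of `c` as an interval.
    (λ τ → mk⇔ (λ ()) λ τ∈S →
      let _ , _ , _ , int , _ = S⇒path τ τ∈S in
      contradiction (isInterval⇒consecutive int) ¬con) ,
    refl

theorem5p2 : ∀ (n t : ℕ) → n ≥ 3 → (1≤t : 1 ≤ t) (t<n : t < n) →
    (c : Vec ℕ t) → All (_∈[1⋯ n ]) c → Unique c →
    c Avoids 132-pattern → c Avoids 312-pattern →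
    let S[132,312] = S n (<⇒≤ t<n) c ((3 , 132-pattern) ∷ (3 , 312-pattern) ∷ []) in
    (Consecutive c → ∣ S[132,312] ∣≐ ((n ∸ t) C (minimum 1≤t c ∸ 1))) ×
    (¬ Consecutive c → ∣ S[132,312] ∣≐ 0)
theorem5p2 n t _ 1≤t t<n c c∈[n] c! ¬132 ¬312
  -- Writing n as t + r lets every permutation split into its first `t` entries and a completion of
  -- length `r`.
  with r , refl ← m≤n⇒∃[o]m+o≡n (<⇒≤ t<n) =
  consecutive , count-¬consecutive 1≤t (<⇒≤ t<n) c
  where
  consecutive : Consecutive c → ∣ _ ∣≐ ((t + r ∸ t) C (minimum 1≤t c ∸ 1))
  consecutive x,iff with a , int ← consecutive⇒isInterval 1≤t (All.map proj₁ c∈[n]) x,iff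
    -- The two rewrites turn the stated binomial coefficient into `r C a`.
    rewrite isInterval-minimum 1≤t c int | m+n∸m≡n t r =
    count-consecutive 1≤t (<⇒≤ t<n) c c! (avoids⇒neverBetween c ¬132 ¬312) int
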